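{- For all $t\in\mathbb{N}$ such that $t\ge 3$, $gr^t_2(B_3)=6$.
   Context: $K_n$ is the complete graph of order $n$. The book $B_n:=K_2+nK_1$ (graph join) is the graph on $n+2$ vertices consisting of an edge $xy$ (the spine) together with $n$ further, pairwise non-adjacent vertices (the pages), each adjacent to both $x$ and $y$. A $t$-coloring of $K_p$ is a map $f:E(K_p)\to\{1,\dots,t\}$, not assumed surjective. A Gallai $t$-coloring is a $t$-coloring with no rainbow triangle, i.e. there are no three vertices $x,y,z$ such that $f(xy),f(xz),f(yz)$ are pairwise distinct. For $1\le s<t$ and a graph $G$, the weakened Gallai-Ramsey number $gr^t_s(G)$ is the least $p\in\mathbb{N}$ such that every Gallai $t$-coloring of $K_p$ contains a (not necessarily induced) subgraph isomorphic to $G$ whose edges use at most $s$ colors. -}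

module Defs where

open import Data.Empty using (⊥)
open import Data.Fin using (Fin)
open import Data.Fin.Subset using (Subset; _∈_; ∣_∣)
open import Data.Nat using (ℕ; _≤_)
open import Data.Product using (Σ-syntax; ∃-syntax; _×_)
open import Data.Sum using (_⊎_; inj₁; inj₂)
open import Data.Unit using (⊤; tt)
open import Function.Definitions using (Injective)
open import Level using (0ℓ)
open import Relation.Binary.Core using (Rel)
open import Relation.Binary.Definitions using (Symmetric; Irreflexive)
open import Relation.Binary.PropositionalEquality using (_≡_; _≢_; refl; ≢-sym)
open import Relation.Nullary using (¬_)

record Graph : Set₁ where
  field
    Vertex   : Set
    Adj      : Rel Vertex 0ℓ
    symm     : Symmetric Adj
    loopless : Irreflexive _≡_ Adj

open Graph public

K : ℕ → Graph
K n = record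
  { Vertex   = Fin n
  ; Adj      = _≢_
  ; symm     = ≢-sym
  ; loopless = λ x≡y x≢y → x≢y x≡y
  }

-- nK₁, the disjoint union of n isolated vertices.
Edgeless : ℕ → Graph
Edgeless n = record
  { Vertex   = Fin n
  ; Adj      = λ _ _ → ⊥
  ; symm     = λ ()
  ; loopless = λ _ ()
  }

module _ (G H : Graph) where

  JoinAdj : Rel (Vertex G ⊎ Vertex H) 0ℓ
  JoinAdj (inj₁ x) (inj₁ y) = Adj G x y
  JoinAdj (inj₁ _) (inj₂ _) = ⊤
  JoinAdj (inj₂ _) (inj₁ _) = ⊤
  JoinAdj (inj₂ x) (inj₂ y) = Adj H x y

  private
    join-symm : Symmetric JoinAdj
    join-symm {inj₁ _} {inj₁ _} e = symm G e
    join-symm {inj₁ _} {inj₂ _} _ = tt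
    join-symm {inj₂ _} {inj₁ _} _ = tt
    join-symm {inj₂ _} {inj₂ _} e = symm H e

    join-loopless : Irreflexive _≡_ JoinAdj
    join-loopless {inj₁ _} refl e = loopless G refl e
    join-loopless {inj₂ _} refl e = loopless H refl e

  join : Graph
  join = record
    { Vertex   = Vertex G ⊎ Vertex H
    ; Adj      = JoinAdj
    ; symm     = λ {x} {y} → join-symm {x} {y}
    ; loopless = λ {x} {y} → join-loopless {x} {y}
    }

Book : ℕ → Graph
Book n = join (K 2) (Edgeless n)

-- An edge {x , y} is presented by any proof of Adj x y or Adj y x.  The second
-- field makes the colour depend on the edge alone: used twice, it also shows
-- that any two proofs of Adj x y receive the same colour.
record Colouring (t : ℕ) (G : Graph) : Set where
  field
    colour      : ∀ {x y} → Adj G x y → Fin t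
    well-formed : ∀ {x y} (e : Adj G x y) (e′ : Adj G y x) → colour e ≡ colour e′

open Colouring public

RainbowTriangle : ∀ {t G} → Colouring t G → Set
RainbowTriangle {G = G} f =
  ∃[ x ] ∃[ y ] ∃[ z ]
  Σ[ xy ∈ Adj G x y ] Σ[ xz ∈ Adj G x z ] Σ[ yz ∈ Adj G y z ]
    (colour f xy ≢ colour f xz × colour f xy ≢ colour f yz × colour f xz ≢ colour f yz)

Gallai : ∀ {t G} → Colouring t G → Set
Gallai f = ¬ RainbowTriangle f

-- A not necessarily induced subgraph of H isomorphic to G, given by the
-- isomorphism: its vertices and edges are the images of those of G.
record Copy (G H : Graph) : Set where
  field
    vertex    : Vertex G → Vertex H
    injective : Injective _≡_ _≡_ vertex
    edge      : ∀ {x y} → Adj G x y → Adj H (vertex x) (vertex y)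

open Copy public

UsesAtMost : ∀ {t G H} → ℕ → Colouring t H → Copy G H → Set
UsesAtMost {t} {G} s f c =
  Σ[ S ∈ Subset t ] (∣ S ∣ ≤ s × (∀ {x y} (e : Adj G x y) → colour f (edge c e) ∈ S))

Forces : (t s : ℕ) → Graph → ℕ → Set
Forces t s G p =
  (f : Colouring t (K p)) → Gallai f → Σ[ c ∈ Copy G (K p) ] UsesAtMost s f c

-- IsGR t s G p says that the weakened Gallai-Ramsey number gr^t_s(G), which is
-- considered for 1 ≤ s < t, exists and equals p.
IsGR : (t s : ℕ) → Graph → ℕ → Set
IsGR t s G p = Forces t s G p × (∀ q → Forces t s G q → p ≤ q)

{-# OPTIONS --safe #-}
-- Upper bound: a colouring of K₆ matters only through which edges share a
-- colour, so every colour may be replaced by the first edge that carries it.  The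
-- resulting words of length 15 are searched edge by edge, a branch being closed as soon
-- as the coloured edges contain a rainbow triangle or a two-coloured book; with
-- the edges in colexicographic order about eight thousand prefixes remain.
--
-- Lower bound: K₅ coloured as a vertex joined in one colour to a K₄ that is
-- split, in two further colours, into a path and its complement.  All three
-- colours appear around every edge, and a book B₃ in K₅ contains every edge that
-- meets its spine.
module Submission where

open import Data.Empty using (⊥)
open import Data.Fin as Fin using (Fin; zero; suc; toℕ; inject≤)
open import Data.Fin.Patterns using (0F; 1F; 2F)
import Data.Fin.Properties as Fin
open import Data.Fin.Subset using (Subset; inside; outside; ⁅_⁆; _∪_; _-_; _∈_; ∣_∣)
open import Data.Fin.Subset.Properties
  using (x∈⁅x⁆; ∣⁅x⁆∣≡1; x∈p∪q⁺; x∈p∧x≢y⇒x∈p-y; x∈p⇒∣p-x∣<∣p∣)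
open import Data.List
  using (List; []; _∷_; _++_; _∷ʳ_; length; map; filter; deduplicate;
         allFin; applyUpTo; cartesianProduct; cartesianProductWith; iterate)
open import Data.List.Extrema.Nat using (max; xs≤max)
open import Data.List.Membership.Propositional using (find; lose) renaming (_∈_ to _∈ₗ_)
open import Data.List.Membership.Propositional.Properties
  using (∈-++⁺ˡ; ∈-++⁺ʳ; ∈-map⁺; ∈-applyUpTo⁺; ∈-deduplicate⁺; ∈-filter⁻)
open import Data.List.Properties using (applyUpTo-∷ʳ; length-applyUpTo; map-cong-local)
open import Data.List.Relation.Unary.All as All using (All; []; _∷_)
import Data.List.Relation.Unary.All.Properties as All
open import Data.List.Relation.Unary.AllPairs using ([]; _∷_)
open import Data.List.Relation.Unary.Any as Any using (Any; here; there)
import Data.List.Relation.Unary.Any.Properties as Any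
open import Data.List.Relation.Unary.Unique.Propositional using (Unique)
open import Data.Nat
  using (ℕ; zero; suc; _+_; _⊔_; _⊓_; _≤_; _<_; _≥_; z≤n; s≤s; s≤s⁻¹; _≟_; _≤?_)
  renaming (∣_-_∣ to ∣_-ℕ_∣)
open import Data.Nat.Combinatorics using (_C_)
open import Data.Nat.Properties
  using (≤-reflexive; ≤-trans; ≰⇒>; 1+n≰n; m≤n⇒m<n∨m≡n; n≤1+n;
         +-monoʳ-≤; +-suc; ⊔-comm; ⊓-comm)
open import Data.List.Relation.Unary.Unique.DecPropositional _≟_ using (unique?)
open import Data.Product using (∃-syntax; _×_; _,_; swap; uncurry)
open import Data.Product.Properties using (≡-dec)
open import Data.Sum using (_⊎_; inj₁; inj₂; [_,_]′)
open import Data.Vec as Vec using (Vec; []; _∷_)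
open import Data.Vec.Membership.Propositional.Properties using (∈-lookup; ∈-toList⁺)
open import Data.Vec.Relation.Unary.All using ([]; _∷_)
open import Data.Vec.Relation.Unary.AllPairs using ([]; _∷_)
  renaming (AllPairs to AllPairsᵛ; allPairs? to allPairsᵛ?)
open import Data.Vec.Relation.Unary.Unique.Propositional.Properties using (lookup-injective)
open import Function using (_∘_; _$_)
open import Function.Definitions using (Injective)
open import Relation.Binary.Definitions using (DecidableEquality)
open import Relation.Binary.PropositionalEquality
  using (_≡_; _≢_; refl; sym; trans; cong; cong₂; subst; ≢-sym; module ≡-Reasoning)
open import Relation.Nullary using (¬_; Dec; yes; no; ¬?; contradiction)
open import Relation.Nullary.Decidable using (_⊎-dec_; _×-dec_; _→-dec_; toWitness)

open import Defs

private variable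
  A : Set
  n t : ℕ

-- Replacing colours by positions

module FirstOccurrence (_≟ᴬ_ : DecidableEquality A) where

  -- The result is n when v does not occur before position n.
  firstBelow : (ℕ → A) → A → ℕ → ℕ
  firstBelow u v zero = zero
  firstBelow u v (suc n) with u 0 ≟ᴬ v
  ... | yes _ = zero
  ... | no _  = suc (firstBelow (u ∘ suc) v n)

  firstBelow-≤ : ∀ u v n → firstBelow u v n ≤ n
  firstBelow-≤ u v zero = z≤n
  firstBelow-≤ u v (suc n) with u 0 ≟ᴬ v
  ... | yes _ = z≤n
  ... | no _  = s≤s (firstBelow-≤ (u ∘ suc) v n)

  firstBelow-correct : ∀ (u : ℕ → A) v n → u n ≡ v → u (firstBelow u v n) ≡ v
  firstBelow-correct u v zero eq = eq
  firstBelow-correct u v (suc n) eq with u 0 ≟ᴬ v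
  ... | yes eq₀ = eq₀
  ... | no _    = firstBelow-correct (u ∘ suc) v n eq

  -- Both searches compare the same terms in the same order. The one with the smaller bound gives up
  -- at an occurrence of `v`, where the longer search stops as well.
  firstBelow-unique : ∀ (u : ℕ → A) v m n → u m ≡ v → u n ≡ v → firstBelow u v m ≡ firstBelow u v n
  firstBelow-unique u v zero zero _ _ = refl
  firstBelow-unique u v zero (suc n) eq _ with u 0 ≟ᴬ v
  ... | yes _  = refl
  ... | no neq = contradiction eq neq
  firstBelow-unique u v (suc m) zero _ eq with u 0 ≟ᴬ v
  ... | yes _  = refl
  ... | no neq = contradiction eq neq
  firstBelow-unique u v (suc m) (suc n) eq eq′ with u 0 ≟ᴬ v
  ... | yes _ = refl
  ... | no _  = cong suc (firstBelow-unique (u ∘ suc) v m n eq eq′)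

  first : (ℕ → A) → ℕ → ℕ
  first u k = firstBelow u (u k) k

  first-≤ : ∀ u k → first u k ≤ k
  first-≤ u k = firstBelow-≤ u (u k) k

  first-correct : ∀ u k → u (first u k) ≡ u k
  first-correct u k = firstBelow-correct u (u k) k refl

  first-cong : ∀ u k l → u k ≡ u l → first u k ≡ first u l
  first-cong u k l eq = trans
    (cong (λ v → firstBelow u v k) eq)
    (firstBelow-unique u (u l) k l eq refl)

  -- Together with `first-≤`, this is all that the search assumes about a word of positions.
  first-idem : ∀ u k → first u (first u k) ≡ first u k
  first-idem u k = first-cong u (first u k) k (first-correct u k)

-- Searching the words of positions

lookupOr : A → List A → ℕ → A
lookupOr d []       _       = d
lookupOr d (x ∷ _)  zero    = x
lookupOr d (_ ∷ xs) (suc k) = lookupOr d xs k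

lookupOr-applyUpTo : ∀ (d : A) f {k n} → k < n → lookupOr d (applyUpTo f n) k ≡ f k
lookupOr-applyUpTo d f {zero}  {suc n} _   = refl
lookupOr-applyUpTo d f {suc k} {suc n} k<n = lookupOr-applyUpTo d (f ∘ suc) (s≤s⁻¹ k<n)

-- One value is fixed as the head and the other is sought in the list, which keeps the test finite.
-- The second value may equal the head, so constant lists qualify.
data TwoValued : List ℕ → Set where
  twoValued : ∀ {x xs} → Any (λ y → All (λ z → z ≡ x ⊎ z ≡ y) xs) (x ∷ xs) → TwoValued (x ∷ xs)

twoValued? : ∀ xs → Dec (TwoValued xs)
twoValued? [] = no λ ()
twoValued? (x ∷ xs)
  with Any.any? (λ y → All.all? (λ z → (z ≟ x) ⊎-dec (z ≟ y)) xs) (x ∷ xs)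
... | yes p = yes (twoValued p)
... | no ¬p = no λ { (twoValued p) → ¬p p }

-- Sets of positions on which a word should be rainbow, respectively two-valued.
Targets : Set
Targets = List (List ℕ) × List (List ℕ)

Hit : Targets → (ℕ → ℕ) → Set
Hit (rs , ds) c = Any (Unique ∘ map c) rs ⊎ Any (TwoValued ∘ map c) ds

hit? : ∀ ts c → Dec (Hit ts c)
hit? (rs , ds) c = Any.any? (unique? ∘ map c) rs ⊎-dec Any.any? (twoValued? ∘ map c) ds

-- A target is filed under its largest position, the moment at which all its entries are known, so
-- each target is tested just once along a branch.
due : Targets → ℕ → Targets
due (rs , ds) m = endingAt rs , endingAt ds
  where endingAt = filter (λ es → max 0 es ≟ m)

module _ {m} {c c′ : ℕ → ℕ} (agree : ∀ {k} → k ≤ m → c k ≡ c′ k) where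

  private
    transfer : ∀ (P : List ℕ → Set) ess →
               Any (P ∘ map c) (filter (λ es → max 0 es ≟ m) ess) → Any (P ∘ map c′) ess
    transfer P ess hits with find hits
    ... | es , es∈ , p with ∈-filter⁻ (λ es → max 0 es ≟ m) es∈
    ... | es∈ess , refl =
      lose es∈ess (subst P (map-cong-local (All.map agree (xs≤max 0 es))) p)

  -- A due target has no position beyond `m`, so a prefix that agrees with the word up to `m` gives
  -- it the same values.
  hit-due : ∀ ts → Hit (due ts m) c → Hit ts c′
  hit-due (rs , ds) = [ inj₁ ∘ transfer Unique rs , inj₂ ∘ transfer TwoValued ds ]′

-- A prefix p of a word of first positions is continued either by a new value, namely the
-- current position length p, or by a value already in p.
Unavoidable : List Targets → List ℕ → Set
Unavoidable []         p = ⊥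
Unavoidable (ts ∷ tss) p =
  All (λ x → Hit ts (lookupOr 0 (p ∷ʳ x)) ⊎ Unavoidable tss (p ∷ʳ x))
      (length p ∷ deduplicate _≟_ p)

unavoidable? : ∀ tss p → Dec (Unavoidable tss p)
unavoidable? []         p = no λ ()
unavoidable? (ts ∷ tss) p = All.all? (λ x → decide (p ∷ʳ x)) (length p ∷ deduplicate _≟_ p)
  where
  decide : ∀ q → Dec (Hit ts (lookupOr 0 q) ⊎ Unavoidable tss q)
  decide q = hit? ts (lookupOr 0 q) ⊎-dec unavoidable? tss q

schedule : Targets → ℕ → ℕ → List Targets
schedule ts m n = map (due ts) (iterate suc m n)

module _ {c : ℕ → ℕ} (c-≤ : ∀ k → c k ≤ k) (c-idem : ∀ k → c (c k) ≡ c k) where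

  -- If `c m` is smaller than `m`, idempotence makes it the entry at position `c m`, hence a value
  -- already in the prefix.
  next∈candidates : ∀ m → let p = applyUpTo c m in c m ∈ₗ length p ∷ deduplicate _≟_ p
  next∈candidates m with m≤n⇒m<n∨m≡n (c-≤ m)
  ... | inj₂ cm≡m = here (trans cm≡m (sym (length-applyUpTo c m)))
  ... | inj₁ cm<m =
    there (∈-deduplicate⁺ _≟_ (subst (_∈ₗ applyUpTo c m) (c-idem m) (∈-applyUpTo⁺ c cm<m)))

  -- The word `c` selects one branch of the search tree. Following it must meet a hit, since a
  -- branch that reaches the end of the schedule is ⊥.
  unavoidable⇒hit : ∀ ts m n → Unavoidable (schedule ts m n) (applyUpTo c m) → Hit ts c
  unavoidable⇒hit ts m (suc n) unav
    with subst (λ q → Hit (due ts m) (lookupOr 0 q) ⊎ Unavoidable (schedule ts (suc m) n) q)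
               (applyUpTo-∷ʳ c m)
               (All.lookup unav (next∈candidates m))
  ... | inj₁ hit  = hit-due (λ k≤m → lookupOr-applyUpTo 0 c (s≤s k≤m)) ts hit
  ... | inj₂ rest = unavoidable⇒hit ts (suc m) n rest

-- Triangles and books of K₆

-- The position of an edge in the colexicographic order.
edgeIndex : Fin n → Fin n → ℕ
edgeIndex x y = (toℕ x ⊔ toℕ y) C 2 + (toℕ x ⊓ toℕ y)

-- An inverse of `edgeIndex` up to orientation: listing the larger endpoint first makes the
-- lexicographic product colexicographic on edges. The default is itself an edge.
endpoints : ℕ → Fin 6 × Fin 6
endpoints = lookupOr (0F , 1F) $ map swap $
  filter (λ (y , x) → x Fin.<? y) (cartesianProduct (allFin 6) (allFin 6))

endpoints-edgeIndex : ∀ x y → x ≢ y →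
  endpoints (edgeIndex x y) ≡ (x , y) ⊎ endpoints (edgeIndex x y) ≡ (y , x)
endpoints-edgeIndex = toWitness {a? = Fin.all? λ x → Fin.all? λ y →
  ¬? (x Fin.≟ y) →-dec
  ((endpoints (edgeIndex x y) ≟ₚ (x , y)) ⊎-dec (endpoints (edgeIndex x y) ≟ₚ (y , x)))} _
  where _≟ₚ_ = ≡-dec Fin._≟_ Fin._≟_

subsequences : ∀ k → List A → List (Vec A k)
subsequences zero    _        = [] ∷ []
subsequences (suc k) []       = []
subsequences (suc k) (x ∷ xs) = map (x ∷_) (subsequences k xs) ++ subsequences (suc k) xs

Distinct : ∀ {k} → Vec (Fin n) k → Set
Distinct = AllPairsᵛ _≢_

distinct? : ∀ {k} (v : Vec (Fin n) k) → Dec (Distinct v)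
distinct? = allPairsᵛ? λ x y → ¬? (x Fin.≟ y)

triangleEdges : Vec (Fin n) 3 → List ℕ
triangleEdges (x ∷ y ∷ z ∷ []) = edgeIndex x y ∷ edgeIndex x z ∷ edgeIndex y z ∷ []

-- The first two vertices form the spine.
bookEdges : ∀ {k} → Vec (Fin n) (2 + k) → List ℕ
bookEdges (x ∷ y ∷ zs) = edgeIndex x y ∷ map (edgeIndex x) pages ++ map (edgeIndex y) pages
  where pages = Vec.toList zs

triangles : List (Vec (Fin 6) 3)
triangles = filter distinct? (subsequences 3 (allFin 6))

-- Spine and pages are both taken in increasing order, so each of the 60 books of K₆ appears once.
books : List (Vec (Fin 6) 5)
books = filter distinct?
  (cartesianProductWith Vec._++_ (subsequences 2 (allFin 6)) (subsequences 3 (allFin 6)))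

triangles-distinct : All Distinct triangles
triangles-distinct = All.all-filter distinct? (subsequences 3 (allFin 6))

books-distinct : All Distinct books
books-distinct = All.all-filter distinct?
  (cartesianProductWith Vec._++_ (subsequences 2 (allFin 6)) (subsequences 3 (allFin 6)))

targets : Targets
targets = map triangleEdges triangles , map bookEdges books

unavoidable : Unavoidable (schedule targets 0 15) []
-- The search itself, run by evaluating the decision procedure over the 15 edges of K₆.
unavoidable = toWitness {a? = unavoidable? (schedule targets 0 15) []} _

-- Colourings and copies

-- Both proofs are compared with the reversed edge.
colour-irrelevant : ∀ {G} (f : Colouring t G) {x y} (e e′ : Adj G x y) → colour f e ≡ colour f e′
colour-irrelevant {G = G} f e e′ =
  trans (well-formed f e (symm G e)) (sym (well-formed f e′ (symm G e)))

restrict : ∀ {G H} → Copy G H → Colouring t H → Colouring t G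
restrict c f .colour e          = colour f (edge c e)
restrict c f .well-formed e e′  = well-formed f (edge c e) (edge c e′)

restrict-gallai : ∀ {G H} (c : Copy G H) (f : Colouring t H) → Gallai f → Gallai (restrict c f)
restrict-gallai c f gallai (x , y , z , xy , xz , yz , distinct) =
  gallai (vertex c x , vertex c y , vertex c z , edge c xy , edge c xz , edge c yz , distinct)

compose : ∀ {F G H} → Copy G H → Copy F G → Copy F H
compose c d .vertex    = vertex c ∘ vertex d
compose c d .injective = injective d ∘ injective c
compose c d .edge      = edge c ∘ edge d

K-mono : ∀ {p q} → p ≤ q → Copy (K p) (K q)
K-mono p≤q .vertex x    = inject≤ x p≤q
K-mono p≤q .injective   = Fin.inject≤-injective p≤q p≤q _ _
K-mono p≤q .edge x≢y eq = x≢y (Fin.inject≤-injective p≤q p≤q _ _ eq)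

-- A colouring of the larger complete graph is restricted to its first `p` vertices, and the copy
-- found there is carried back.
forces-mono : ∀ {t s G p q} → p ≤ q → Forces t s G p → Forces t s G q
forces-mono p≤q forces f gallai
  with forces (restrict (K-mono p≤q) f) (restrict-gallai (K-mono p≤q) f gallai)
... | c , uses = compose (K-mono p≤q) c , uses

∣p∪q∣≤∣p∣+∣q∣ : ∀ (p q : Subset n) → ∣ p ∪ q ∣ ≤ ∣ p ∣ + ∣ q ∣
∣p∪q∣≤∣p∣+∣q∣ [] [] = z≤n
∣p∪q∣≤∣p∣+∣q∣ (outside ∷ p) (outside ∷ q) = ∣p∪q∣≤∣p∣+∣q∣ p q
∣p∪q∣≤∣p∣+∣q∣ (outside ∷ p) (inside  ∷ q) =
  ≤-trans (s≤s (∣p∪q∣≤∣p∣+∣q∣ p q)) (≤-reflexive (sym (+-suc ∣ p ∣ ∣ q ∣)))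
∣p∪q∣≤∣p∣+∣q∣ (inside  ∷ p) (outside ∷ q) = s≤s (∣p∪q∣≤∣p∣+∣q∣ p q)
∣p∪q∣≤∣p∣+∣q∣ (inside  ∷ p) (inside  ∷ q) =
  s≤s (≤-trans (∣p∪q∣≤∣p∣+∣q∣ p q) (+-monoʳ-≤ ∣ p ∣ (n≤1+n ∣ q ∣)))

∣⁅x⁆∪⁅y⁆∣≤2 : ∀ (x y : Fin n) → ∣ ⁅ x ⁆ ∪ ⁅ y ⁆ ∣ ≤ 2
∣⁅x⁆∪⁅y⁆∣≤2 x y =
  ≤-trans (∣p∪q∣≤∣p∣+∣q∣ ⁅ x ⁆ ⁅ y ⁆) (≤-reflexive (cong₂ _+_ (∣⁅x⁆∣≡1 x) (∣⁅x⁆∣≡1 y)))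

-- Induction on `k`: removing `g 0F` from `p` leaves room for the remaining values and lowers the
-- size.
injective-into⇒≤ : ∀ {k} {g : Fin k → Fin n} {p : Subset n} →
                   Injective _≡_ _≡_ g → (∀ i → g i ∈ p) → k ≤ ∣ p ∣
injective-into⇒≤ {k = zero}  _   _  = z≤n
injective-into⇒≤ {k = suc k} {g} {p} inj g∈p = ≤-trans
  (s≤s (injective-into⇒≤ {g = g ∘ suc} {p - g 0F} (Fin.suc-injective ∘ inj)
    (λ i → x∈p∧x≢y⇒x∈p-y (g∈p (suc i)) (λ eq → contradiction (inj eq) λ ()))))
  (x∈p⇒∣p-x∣<∣p∣ (g∈p 0F))

-- Pigeonhole: a missed `y` would extend `f` to an injection from `Fin (suc n)` into `Fin n`.
injective⇒surjective : ∀ {f : Fin n → Fin n} → Injective _≡_ _≡_ f → ∀ y → ∃[ x ] f x ≡ y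
injective⇒surjective {n} {f} inj y with Fin.any? (λ x → f x Fin.≟ y)
... | yes x↦y = x↦y
... | no ¬x↦y = contradiction (Fin.injective⇒≤ g-injective) 1+n≰n
  where
  g : Fin (suc n) → Fin n
  g zero    = y
  g (suc x) = f x

  g-injective : Injective _≡_ _≡_ g
  g-injective {zero}  {zero}  _  = refl
  g-injective {zero}  {suc x} eq = contradiction (x , sym eq) ¬x↦y
  g-injective {suc x} {zero}  eq = contradiction (x , eq) ¬x↦y
  g-injective {suc x} {suc _} eq = cong suc (inj eq)

-- The upper bound

edgeIndex-comm : ∀ (x y : Fin n) → edgeIndex x y ≡ edgeIndex y x
edgeIndex-comm x y =
  cong₂ (λ a b → a C 2 + b) (⊔-comm (toℕ x) (toℕ y)) (⊓-comm (toℕ x) (toℕ y))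

module _ {k} (v : Vec (Fin n) (2 + k)) where

  bookVertex : Fin 2 ⊎ Fin k → Fin n
  bookVertex = Vec.lookup v ∘ Fin.join 2 k

  bookVertex-injective : Distinct v → Injective _≡_ _≡_ bookVertex
  bookVertex-injective distinct {a} {b} eq = begin
    a                               ≡⟨ Fin.splitAt-join 2 k a ⟨
    Fin.splitAt 2 (Fin.join 2 k a)  ≡⟨ cong (Fin.splitAt 2) (lookup-injective distinct _ _ eq) ⟩
    Fin.splitAt 2 (Fin.join 2 k b)  ≡⟨ Fin.splitAt-join 2 k b ⟩
    b                               ∎
    where open ≡-Reasoning

  bookCopy : Distinct v → Copy (Book k) (K n)
  bookCopy distinct .vertex            = bookVertex
  bookCopy distinct .injective         = bookVertex-injective distinct
  bookCopy distinct .edge {a} {b} e eq =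
    loopless (Book k) {a} {b} (bookVertex-injective distinct eq) e

spine-∈-bookEdges : ∀ {k} (v : Vec (Fin n) (2 + k)) s b → Adj (Book k) (inj₁ s) b →
  edgeIndex (bookVertex v (inj₁ s)) (bookVertex v b) ∈ₗ bookEdges v
spine-∈-bookEdges (x ∷ y ∷ zs) 0F (inj₁ 0F) e = contradiction refl e
spine-∈-bookEdges (x ∷ y ∷ zs) 0F (inj₁ 1F) _ = here refl
spine-∈-bookEdges (x ∷ y ∷ zs) 1F (inj₁ 0F) _ = here (edgeIndex-comm y x)
spine-∈-bookEdges (x ∷ y ∷ zs) 1F (inj₁ 1F) e = contradiction refl e
spine-∈-bookEdges (x ∷ y ∷ zs) 0F (inj₂ j)  _ =
  there (∈-++⁺ˡ (∈-map⁺ (edgeIndex x) (∈-toList⁺ (∈-lookup j zs))))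
spine-∈-bookEdges (x ∷ y ∷ zs) 1F (inj₂ j)  _ =
  there (∈-++⁺ʳ _ (∈-map⁺ (edgeIndex y) (∈-toList⁺ (∈-lookup j zs))))

-- Pages are pairwise non-adjacent, so every edge has an end on the spine, after reversal if
-- necessary.
∈-bookEdges : ∀ {k} (v : Vec (Fin n) (2 + k)) a b → Adj (Book k) a b →
  edgeIndex (bookVertex v a) (bookVertex v b) ∈ₗ bookEdges v
∈-bookEdges v (inj₁ s)   b        e = spine-∈-bookEdges v s b e
∈-bookEdges v a@(inj₂ _) (inj₁ s) _ =
  subst (_∈ₗ bookEdges v) (edgeIndex-comm (bookVertex v (inj₁ s)) (bookVertex v a))
    (spine-∈-bookEdges v s a _)

twoValued⇒All : ∀ {xs} → TwoValued xs → ∃[ x ] ∃[ y ] All (λ z → z ≡ x ⊎ z ≡ y) xs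
twoValued⇒All (twoValued {x} some) with Any.satisfied some
... | y , all = x , y , inj₁ refl ∷ all

module _ (f : Colouring t (K n)) (u : ℕ → Fin t)
         (u-edgeIndex : ∀ {x y} (e : x ≢ y) → u (edgeIndex x y) ≡ colour f e) where

  open FirstOccurrence (Fin._≟_ {t})

  private
    colour-≢ : ∀ {x y z w} (e : x ≢ y) (e′ : z ≢ w) →
               first u (edgeIndex x y) ≢ first u (edgeIndex z w) → colour f e ≢ colour f e′
    colour-≢ {x} {y} {z} {w} e e′ neq eq = neq $ first-cong u (edgeIndex x y) (edgeIndex z w) $
      trans (u-edgeIndex e) (trans eq (sym (u-edgeIndex e′)))

    colour-≡ : ∀ {k l} → first u k ≡ l → u k ≡ u l
    colour-≡ {k} eq = trans (sym (first-correct u k)) (cong u eq)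

    colour-among : ∀ {i j k} → first u k ≡ i ⊎ first u k ≡ j → u k ∈ ⁅ u i ⁆ ∪ ⁅ u j ⁆
    colour-among {i} {j} {k} (inj₁ eq) =
      x∈p∪q⁺ (inj₁ (subst (_∈ ⁅ u i ⁆) (sym (colour-≡ {k} eq)) (x∈⁅x⁆ (u i))))
    colour-among {i} {j} {k} (inj₂ eq) =
      x∈p∪q⁺ (inj₂ (subst (_∈ ⁅ u j ⁆) (sym (colour-≡ {k} eq)) (x∈⁅x⁆ (u j))))

  unique⇒rainbow : (v : Vec (Fin n) 3) → Distinct v →
    Unique (map (first u) (triangleEdges v)) → RainbowTriangle f
  unique⇒rainbow (x ∷ y ∷ z ∷ []) ((xy ∷ xz ∷ []) ∷ (yz ∷ []) ∷ _)
    ((xy≢xz ∷ xy≢yz ∷ []) ∷ (xz≢yz ∷ []) ∷ _) =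
    x , y , z , xy , xz , yz ,
    colour-≢ xy xz xy≢xz , colour-≢ xy yz xy≢yz , colour-≢ xz yz xz≢yz

  -- The two values `i` and `j` are positions; reading `u` there turns them into the at most two
  -- colours of the book.
  twoValued⇒book : ∀ {k} (v : Vec (Fin n) (2 + k)) → Distinct v →
    TwoValued (map (first u) (bookEdges v)) → ∃[ c ] UsesAtMost {G = Book k} 2 f c
  twoValued⇒book v distinct two with twoValued⇒All two
  ... | i , j , ij = bookCopy v distinct , ⁅ u i ⁆ ∪ ⁅ u j ⁆ , ∣⁅x⁆∪⁅y⁆∣≤2 (u i) (u j) ,
    λ {a} {b} e → subst (_∈ ⁅ u i ⁆ ∪ ⁅ u j ⁆)
      (u-edgeIndex (edge (bookCopy v distinct) {a} {b} e))
      (colour-among {i} {j} {edgeIndex (bookVertex v a) (bookVertex v b)}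
        (All.lookup (All.map⁻ ij) (∈-bookEdges v a b e)))

module _ (f : Colouring t (K 6)) where

  private
    pairColour : Fin 6 → Fin 6 → Fin t
    pairColour x y with x Fin.≟ y
    -- A filler for the diagonal: `Fin t` has no element to hand, so the colour of a fixed edge is
    -- borrowed.
    ... | yes _  = colour f {0F} {1F} λ ()
    ... | no x≢y = colour f x≢y

    pairColour-≡ : ∀ {x y} (e : x ≢ y) → pairColour x y ≡ colour f e
    pairColour-≡ {x} {y} e with x Fin.≟ y
    ... | yes x≡y = contradiction x≡y e
    ... | no x≢y  = colour-irrelevant f x≢y e

  edgeColour : ℕ → Fin t
  edgeColour = uncurry pairColour ∘ endpoints

  edgeColour-edgeIndex : ∀ {x y} (e : x ≢ y) → edgeColour (edgeIndex x y) ≡ colour f e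
  edgeColour-edgeIndex {x} {y} e with endpoints-edgeIndex x y e
  ... | inj₁ eq = trans (cong (uncurry pairColour) eq) (pairColour-≡ e)
  ... | inj₂ eq = trans (cong (uncurry pairColour) eq)
                        (trans (pairColour-≡ (≢-sym e)) (well-formed f (≢-sym e) e))

forces-six : Forces t 2 (Book 3) 6
forces-six {t} f gallai =
  [ (λ hits → let v , distinct , unique = extract {edges = triangleEdges} triangles-distinct hits in
              contradiction (unique⇒rainbow f u u-edgeIndex v distinct unique) gallai)
  , (λ hits → let v , distinct , two = extract {edges = bookEdges} books-distinct hits in
              twoValued⇒book f u u-edgeIndex v distinct two)
  ]′ (unavoidable⇒hit (first-≤ u) (first-idem u) targets 0 15 unavoidable)
  where
  open FirstOccurrence (Fin._≟_ {t})

  u = edgeColour f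
  u-edgeIndex = edgeColour-edgeIndex f

  extract : ∀ {k} {edges : Vec (Fin 6) k → List ℕ} {P : List ℕ → Set} {vs} →
            All Distinct vs → Any P (map edges vs) → ∃[ v ] (Distinct v × P (edges v))
  extract distinct hits = Any.lookup hits′ , All.lookupAny distinct hits′
    where hits′ = Any.map⁻ hits

-- The lower bound

pathColour : Fin 5 → Fin 5 → Fin 3
pathColour zero    _       = 0F
pathColour (suc _) zero    = 0F
pathColour (suc x) (suc y) with ∣ toℕ x -ℕ toℕ y ∣ ≟ 1
... | yes _ = 1F
... | no _  = 2F

pathColour-comm : ∀ x y → pathColour x y ≡ pathColour y x
pathColour-comm = toWitness {a? = Fin.all? λ x → Fin.all? λ y →
  pathColour x y Fin.≟ pathColour y x} _

-- Two of the pairs at vertex 0 share colour `0F`; away from vertex 0 only two colours occur.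
pathColour-gallai : ∀ x y z →
  pathColour x y ≡ pathColour x z ⊎ pathColour x y ≡ pathColour y z ⊎ pathColour x z ≡ pathColour y z
pathColour-gallai = toWitness {a? = Fin.all? λ x → Fin.all? λ y → Fin.all? λ z →
  (pathColour x y Fin.≟ pathColour x z) ⊎-dec
  (pathColour x y Fin.≟ pathColour y z) ⊎-dec
  (pathColour x z Fin.≟ pathColour y z)} _

-- One of `x` and `y` differs from vertex 0. It sees `0F` towards vertex 0, and both other colours
-- because neither a path on four vertices nor its complement has an isolated vertex.
pathColour-around : ∀ x y i → x ≢ y →
  ∃[ w ] (x ≢ w × pathColour x w ≡ i ⊎ y ≢ w × pathColour y w ≡ i)
pathColour-around = toWitness {a? = Fin.all? λ x → Fin.all? λ y → Fin.all? λ i →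
  ¬? (x Fin.≟ y) →-dec Fin.any? λ w →
  (¬? (x Fin.≟ w) ×-dec (pathColour x w Fin.≟ i)) ⊎-dec
  (¬? (y Fin.≟ w) ×-dec (pathColour y w Fin.≟ i))} _

spine-adj : ∀ {k} s b → inj₁ s ≢ b → Adj (Book k) (inj₁ s) b
spine-adj s (inj₁ s′) neq = neq ∘ cong inj₁
spine-adj s (inj₂ _)  _   = _

module _ (3≤t : 3 ≤ t) where

  private
    embed : Fin 3 → Fin t
    embed i = inject≤ i 3≤t

    embed-injective : Injective _≡_ _≡_ embed
    embed-injective = Fin.inject≤-injective 3≤t 3≤t _ _

  pathColouring : Colouring t (K 5)
  pathColouring .colour {x} {y} _        = embed (pathColour x y)
  pathColouring .well-formed {x} {y} _ _ = cong embed (pathColour-comm x y)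

  pathColouring-gallai : Gallai pathColouring
  pathColouring-gallai (x , y , z , _ , _ , _ , xy≢xz , xy≢yz , xz≢yz)
    with pathColour-gallai x y z
  ... | inj₁ eq        = xy≢xz (cong embed eq)
  ... | inj₂ (inj₁ eq) = xy≢yz (cong embed eq)
  ... | inj₂ (inj₂ eq) = xz≢yz (cong embed eq)

  ¬forces-five : ¬ Forces t 2 (Book 3) 5
  ¬forces-five forces with forces pathColouring pathColouring-gallai
  ... | c , S , ∣S∣≤2 , colours∈S =
    -- All three embedded colours lie in `S`, which has at most two elements.
    contradiction (≤-trans (injective-into⇒≤ embed-injective embed∈S) ∣S∣≤2) 1+n≰n
    where
    -- The book has 2 + 3 vertices, so its copy spans K₅; `splitAt` turns this into an injection of
    -- `Fin 5` into itself.
    vertex-surjective : ∀ w → ∃[ b ] vertex c b ≡ w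
    vertex-surjective w with injective⇒surjective (splitAt-injective ∘ injective c) w
      where
      splitAt-injective : Injective _≡_ _≡_ (Fin.splitAt 2 {3})
      splitAt-injective {i} {j} eq =
        trans (sym (Fin.join-splitAt 2 3 i)) (trans (cong (Fin.join 2 3) eq) (Fin.join-splitAt 2 3 j))
    ... | i , eq = Fin.splitAt 2 i , eq

    spine : Fin 2 → Fin 5
    spine s = vertex c (inj₁ s)

    around-spine : ∀ s w → spine s ≢ w → embed (pathColour (spine s) w) ∈ S
    around-spine s w neq with vertex-surjective w
    ... | b , refl = colours∈S {inj₁ s} {b} (spine-adj s b (neq ∘ cong (vertex c)))

    embed∈S : ∀ i → embed i ∈ S
    embed∈S i with pathColour-around (spine 0F) (spine 1F) i
                     (λ eq → contradiction (injective c eq) λ ())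
    ... | w , inj₁ (neq , eq) = subst (λ j → embed j ∈ S) eq (around-spine 0F w neq)
    ... | w , inj₂ (neq , eq) = subst (λ j → embed j ∈ S) eq (around-spine 1F w neq)

theorem3p1 : (t : ℕ) → t ≥ 3 → IsGR t 2 (Book 3) 6
theorem3p1 t t≥3 = forces-six , least
  where
  least : ∀ q → Forces t 2 (Book 3) q → 6 ≤ q
  least q forces with 6 ≤? q
  ... | yes 6≤q = 6≤q
  -- Here `q` is at most 5, so forcing at `q` would pass up to K₅.
  ... | no 6≰q  = contradiction (forces-mono (s≤s⁻¹ (≰⇒> 6≰q)) forces) (¬forces-five t≥3)
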